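{- Let $W\subset S^1$ with $|W|=4$, and suppose $R(W)$ holds, i.e., there exists $w_0\in W$ such that $\tau_{w_0}(W\setminus\{w_0\})\cap W=\emptyset$. Then $P(W)$ holds.
   Context: Identify $S^1$ with $\mathbb{R}/\mathbb{Z}$ (so $x\mapsto x+\tfrac12$ is the antipodal map). The group $O(2)$ acts on $S^1$ by translations $\sigma_a(x)=x+a$ and reflections $\tau_a(x)=-x+2a$. A coloring $c:S^1\to\{R,B\}$ is distinguishing if no non-identity $\gamma\in O(2)$ satisfies $c\circ\gamma=c$. For $W\subset S^1$ with trivial pointwise stabilizer in $O(2)$, $P(W)$ holds if every precoloring $c:S^1\setminus W\to\{R,B\}$ extends to a distinguishing coloring of $S^1$. -}

module Defs where

open import Algebra.Bundles using (AbelianGroup)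
open import Data.Fin.Base using (Fin)
open import Data.Integer.Base as ℤ using (ℤ)
import Data.Integer.Properties as ℤ
open import Data.Nat.Base as ℕ using (ℕ)
import Data.Nat.Properties as ℕ
open import Data.Product.Base using (Σ; ∃-syntax; _×_; _,_; proj₁)
open import Data.Rational.Base as ℚ using (ℚ; 0ℚ; ½)
import Data.Rational.Properties as ℚ
import Data.Rational.Unnormalised.Base as ℚᵘ
import Data.Rational.Unnormalised.Properties as ℚᵘ
open import Data.Rational.Solver using (module +-*-Solver)
open import Function.Bundles using (Bijection; _⟶ₛ_; _⟨$⟩_)
open import Level using (0ℓ)
open import Relation.Binary.Bundles using (Setoid)
import Relation.Binary.Construct.On as On
open import Relation.Binary.Definitions using (_Respects_)
open import Relation.Binary.PropositionalEquality as ≡ using (_≡_; refl; sym; trans; cong; cong₂; subst)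
open import Relation.Nullary.Negation using (¬_)
open import Relation.Unary using (Pred; _∈_; _∉_; _∩_; Empty)

open +-*-Solver using (solve; _:=_; _:+_; _:-_; :-_)

-- The real line as an additive group: rational Cauchy sequences modulo
-- null sequences.

Null : (ℕ → ℚ) → Set
Null f = ∀ ε → 0ℚ ℚ.< ε → ∃[ N ] (∀ n → N ℕ.≤ n → ℚ.∣ f n ∣ ℚ.< ε)

Cauchy : (ℕ → ℚ) → Set
Cauchy f = ∀ ε → 0ℚ ℚ.< ε →
  ∃[ N ] (∀ m n → N ℕ.≤ m → N ℕ.≤ n → ℚ.∣ f m ℚ.- f n ∣ ℚ.< ε)

record ℝ : Set where
  constructor mkℝ
  field
    seq    : ℕ → ℚ
    cauchy : Cauchy seq

open ℝ public

infix 4 _≈ℝ_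
_≈ℝ_ : ℝ → ℝ → Set
x ≈ℝ y = Null (λ n → seq x n ℚ.- seq y n)

private
  half>0 : ∀ {ε} → 0ℚ ℚ.< ε → 0ℚ ℚ.< ½ ℚ.* ε
  half>0 {ε} ε>0 = subst (ℚ._< ½ ℚ.* ε) (ℚ.*-zeroʳ ½) (ℚ.*-monoʳ-<-pos ½ ε>0)

  halves : ∀ ε → ½ ℚ.* ε ℚ.+ ½ ℚ.* ε ≡ ε
  halves ε = trans (sym (ℚ.*-distribʳ-+ ε ½ ½)) (ℚ.*-identityˡ ε)

  ∣+∣<ε : ∀ {ε} p q → ℚ.∣ p ∣ ℚ.< ½ ℚ.* ε → ℚ.∣ q ∣ ℚ.< ½ ℚ.* ε → ℚ.∣ p ℚ.+ q ∣ ℚ.< ε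
  ∣+∣<ε {ε} p q p< q< = ℚ.≤-<-trans (ℚ.∣p+q∣≤∣p∣+∣q∣ p q)
    (subst (ℚ.∣ p ∣ ℚ.+ ℚ.∣ q ∣ ℚ.<_) (halves ε) (ℚ.+-mono-< p< q<))

Null-resp-≗ : ∀ {f g} → (∀ n → f n ≡ g n) → Null f → Null g
Null-resp-≗ f≗g f→0 ε ε>0 with f→0 ε ε>0
... | N , f< = N , λ n N≤n → subst (λ p → ℚ.∣ p ∣ ℚ.< ε) (f≗g n) (f< n N≤n)

Null-0 : ∀ {f} → (∀ n → f n ≡ 0ℚ) → Null f
Null-0 f≗0 ε ε>0 = 0 , λ n _ → subst (λ p → ℚ.∣ p ∣ ℚ.< ε) (sym (f≗0 n)) ε>0

Null-neg : ∀ {f} → Null f → Null (λ n → ℚ.- f n)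
Null-neg {f} f→0 ε ε>0 with f→0 ε ε>0
... | N , f< = N , λ n N≤n → subst (ℚ._< ε) (sym (ℚ.∣-p∣≡∣p∣ (f n))) (f< n N≤n)

Null-+ : ∀ {f g} → Null f → Null g → Null (λ n → f n ℚ.+ g n)
Null-+ {f} {g} f→0 g→0 ε ε>0
  with f→0 (½ ℚ.* ε) (half>0 ε>0) | g→0 (½ ℚ.* ε) (half>0 ε>0)
... | M , f< | N , g< = M ℕ.⊔ N , λ n h → ∣+∣<ε (f n) (g n)
  (f< n (ℕ.≤-trans (ℕ.m≤m⊔n M N) h)) (g< n (ℕ.≤-trans (ℕ.m≤n⊔m M N) h))

≗⇒≈ℝ : ∀ {x y} → (∀ n → seq x n ≡ seq y n) → x ≈ℝ y
≗⇒≈ℝ {x} {y} x≗y =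
  Null-0 λ n → trans (cong (ℚ._- seq y n) (x≗y n)) (ℚ.+-inverseʳ (seq y n))

constℝ : ℚ → ℝ
constℝ q = mkℝ (λ _ → q) λ ε ε>0 →
  0 , λ _ _ _ _ → subst (λ p → ℚ.∣ p ∣ ℚ.< ε) (sym (ℚ.+-inverseʳ q)) ε>0

infixl 6 _+ℝ_
_+ℝ_ : ℝ → ℝ → ℝ
x +ℝ y = mkℝ (λ n → seq x n ℚ.+ seq y n) λ ε ε>0 →
  let M , x< = cauchy x (½ ℚ.* ε) (half>0 ε>0)
      N , y< = cauchy y (½ ℚ.* ε) (half>0 ε>0)
      M≤ = ℕ.m≤m⊔n M N
      N≤ = ℕ.m≤n⊔m M N
  in M ℕ.⊔ N , λ m n hm hn →
    subst (λ p → ℚ.∣ p ∣ ℚ.< ε)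
      (solve 4 (λ a b c d → (a :- b) :+ (c :- d) := (a :+ c) :- (b :+ d)) refl
        (seq x m) (seq x n) (seq y m) (seq y n))
      (∣+∣<ε _ _ (x< m n (ℕ.≤-trans M≤ hm) (ℕ.≤-trans M≤ hn))
                 (y< m n (ℕ.≤-trans N≤ hm) (ℕ.≤-trans N≤ hn)))

infix 8 -ℝ_
-ℝ_ : ℝ → ℝ
-ℝ x = mkℝ (λ n → ℚ.- seq x n) λ ε ε>0 →
  let N , x< = cauchy x ε ε>0
  in N , λ m n hm hn → subst (ℚ._< ε)
    (trans (sym (ℚ.∣-p∣≡∣p∣ (seq x m ℚ.- seq x n)))
      (cong ℚ.∣_∣ (solve 2 (λ a b → :- (a :- b) := (:- a) :- (:- b)) refl (seq x m) (seq x n))))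
    (x< m n hm hn)

ℝ-+-abelianGroup : AbelianGroup 0ℓ 0ℓ
ℝ-+-abelianGroup = record
  { Carrier = ℝ
  ; _≈_     = _≈ℝ_
  ; _∙_     = _+ℝ_
  ; ε       = constℝ 0ℚ
  ; _⁻¹     = -ℝ_
  ; isAbelianGroup = record
    { isGroup = record
      { isMonoid = record
        { isSemigroup = record
          { isMagma = record
            { isEquivalence = record
              { refl  = λ {x} → ≗⇒≈ℝ {x} {x} λ _ → refl
              ; sym   = λ {x} {y} p → Null-resp-≗
                  (λ n → solve 2 (λ a b → :- (a :- b) := b :- a) refl (seq x n) (seq y n))
                  (Null-neg p)
              ; trans = λ {x} {y} {z} p q → Null-resp-≗
                  (λ n → solve 3 (λ a b c → (a :- b) :+ (b :- c) := a :- c) refl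
                    (seq x n) (seq y n) (seq z n))
                  (Null-+ p q)
              }
            ; ∙-cong = λ {x} {y} {u} {v} p q → Null-resp-≗
                (λ n → solve 4 (λ a b c d → (a :- b) :+ (c :- d) := (a :+ c) :- (b :+ d)) refl
                  (seq x n) (seq y n) (seq u n) (seq v n))
                (Null-+ p q)
            }
          ; assoc = λ x y z → ≗⇒≈ℝ {(x +ℝ y) +ℝ z} {x +ℝ (y +ℝ z)}
              λ n → ℚ.+-assoc (seq x n) (seq y n) (seq z n)
          }
        ; identity =
            (λ x → ≗⇒≈ℝ {constℝ 0ℚ +ℝ x} {x} λ n → ℚ.+-identityˡ (seq x n))
          , (λ x → ≗⇒≈ℝ {x +ℝ constℝ 0ℚ} {x} λ n → ℚ.+-identityʳ (seq x n))
        }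
      ; inverse =
          (λ x → ≗⇒≈ℝ { -ℝ x +ℝ x} {constℝ 0ℚ} λ n → ℚ.+-inverseˡ (seq x n))
        , (λ x → ≗⇒≈ℝ {x +ℝ -ℝ x} {constℝ 0ℚ} λ n → ℚ.+-inverseʳ (seq x n))
      ; ⁻¹-cong = λ {x} {y} p → Null-resp-≗
          (λ n → solve 2 (λ a b → :- (a :- b) := (:- a) :- (:- b)) refl (seq x n) (seq y n))
          (Null-neg p)
      }
    ; comm = λ x y → ≗⇒≈ℝ {x +ℝ y} {y +ℝ x} λ n → ℚ.+-comm (seq x n) (seq y n)
    }
  }

-- The circle ℝ/ℤ: the reals, with equality up to an integer.

ℤ⇒ℚ : ℤ → ℚ
ℤ⇒ℚ k = k ℚ./ 1

infix 4 _≈_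
_≈_ : ℝ → ℝ → Set
x ≈ y = ∃[ k ] x +ℝ -ℝ y ≈ℝ constℝ (ℤ⇒ℚ k)

private
  ℤ⇒ℚᵘ : ∀ k → ℚ.toℚᵘ (ℤ⇒ℚ k) ℚᵘ.≃ ℚᵘ.mkℚᵘ k 0
  ℤ⇒ℚᵘ k = ℚ.toℚᵘ-fromℚᵘ (ℚᵘ.mkℚᵘ k 0)

ℤ⇒ℚ-+ : ∀ j k → ℤ⇒ℚ j ℚ.+ ℤ⇒ℚ k ≡ ℤ⇒ℚ (j ℤ.+ k)
ℤ⇒ℚ-+ j k = ℚ.toℚᵘ-injective (begin
  ℚ.toℚᵘ (ℤ⇒ℚ j ℚ.+ ℤ⇒ℚ k)               ≈⟨ ℚ.toℚᵘ-homo-+ (ℤ⇒ℚ j) (ℤ⇒ℚ k) ⟩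
  ℚ.toℚᵘ (ℤ⇒ℚ j) ℚᵘ.+ ℚ.toℚᵘ (ℤ⇒ℚ k)     ≈⟨ ℚᵘ.+-cong (ℤ⇒ℚᵘ j) (ℤ⇒ℚᵘ k) ⟩
  ℚᵘ.mkℚᵘ j 0 ℚᵘ.+ ℚᵘ.mkℚᵘ k 0           ≈⟨ ℚᵘ.*≡* (cong (ℤ._* ℤ.1ℤ) (cong₂ ℤ._+_ (ℤ.*-identityʳ j) (ℤ.*-identityʳ k))) ⟩
  ℚᵘ.mkℚᵘ (j ℤ.+ k) 0                    ≈⟨ ℤ⇒ℚᵘ (j ℤ.+ k) ⟨
  ℚ.toℚᵘ (ℤ⇒ℚ (j ℤ.+ k))                 ∎)
  where open ℚᵘ.≃-Reasoning

ℤ⇒ℚ-neg : ∀ k → ℚ.- ℤ⇒ℚ k ≡ ℤ⇒ℚ (ℤ.- k)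
ℤ⇒ℚ-neg k = ℚ.toℚᵘ-injective (begin
  ℚ.toℚᵘ (ℚ.- ℤ⇒ℚ k)      ≈⟨ ℚ.toℚᵘ-homo‿- (ℤ⇒ℚ k) ⟩
  ℚᵘ.- ℚ.toℚᵘ (ℤ⇒ℚ k)     ≈⟨ ℚᵘ.-‿cong (ℤ⇒ℚᵘ k) ⟩
  ℚᵘ.mkℚᵘ (ℤ.- k) 0       ≈⟨ ℤ⇒ℚᵘ (ℤ.- k) ⟨
  ℚ.toℚᵘ (ℤ⇒ℚ (ℤ.- k))    ∎)
  where open ℚᵘ.≃-Reasoning

≈ℝ⇒≈ : ∀ {x y} → x ≈ℝ y → x ≈ y
≈ℝ⇒≈ {x} {y} p = ℤ.0ℤ , Null-resp-≗ (λ n → sym (ℚ.+-identityʳ (seq x n ℚ.- seq y n))) p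

≈-sym : ∀ {x y} → x ≈ y → y ≈ x
≈-sym {x} {y} (k , p) = ℤ.- k , Null-resp-≗
  (λ n → trans
    (solve 3 (λ a b c → :- ((a :- b) :- c) := (b :- a) :- (:- c)) refl (seq x n) (seq y n) (ℤ⇒ℚ k))
    (cong (λ q → (seq y n ℚ.- seq x n) ℚ.- q) (ℤ⇒ℚ-neg k)))
  (Null-neg p)

≈-trans : ∀ {x y z} → x ≈ y → y ≈ z → x ≈ z
≈-trans {x} {y} {z} (j , p) (k , q) = j ℤ.+ k , Null-resp-≗
  (λ n → trans
    (solve 5 (λ a b c s t → ((a :- b) :- s) :+ ((b :- c) :- t) := (a :- c) :- (s :+ t)) refl
      (seq x n) (seq y n) (seq z n) (ℤ⇒ℚ j) (ℤ⇒ℚ k))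
    (cong (λ q → (seq x n ℚ.- seq z n) ℚ.- q) (ℤ⇒ℚ-+ j k)))
  (Null-+ p q)

+-cong : ∀ {x y u v} → x ≈ y → u ≈ v → x +ℝ u ≈ y +ℝ v
+-cong {x} {y} {u} {v} (j , p) (k , q) = j ℤ.+ k , Null-resp-≗
  (λ n → trans
    (solve 6 (λ a b c d s t →
        ((a :- b) :- s) :+ ((c :- d) :- t) := ((a :+ c) :- (b :+ d)) :- (s :+ t)) refl
      (seq x n) (seq y n) (seq u n) (seq v n) (ℤ⇒ℚ j) (ℤ⇒ℚ k))
    (cong (λ q → ((seq x n ℚ.+ seq u n) ℚ.- (seq y n ℚ.+ seq v n)) ℚ.- q) (ℤ⇒ℚ-+ j k)))
  (Null-+ p q)

-‿cong : ∀ {x y} → x ≈ y → -ℝ x ≈ -ℝ y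
-‿cong {x} {y} (k , p) = ℤ.- k , Null-resp-≗
  (λ n → trans
    (solve 3 (λ a b c → :- ((a :- b) :- c) := ((:- a) :- (:- b)) :- (:- c)) refl
      (seq x n) (seq y n) (ℤ⇒ℚ k))
    (cong (λ q → (ℚ.- seq x n ℚ.- ℚ.- seq y n) ℚ.- q) (ℤ⇒ℚ-neg k)))
  (Null-neg p)

S¹-abelianGroup : AbelianGroup 0ℓ 0ℓ
S¹-abelianGroup = record
  { Carrier = ℝ
  ; _≈_     = _≈_
  ; _∙_     = _+ℝ_
  ; ε       = constℝ 0ℚ
  ; _⁻¹     = -ℝ_
  ; isAbelianGroup = record
    { isGroup = record
      { isMonoid = record
        { isSemigroup = record
          { isMagma = record
            { isEquivalence = record
              { refl  = λ {x} → ≈ℝ⇒≈ {x} {x} (A.refl {x})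
              ; sym   = λ {x} {y} → ≈-sym {x} {y}
              ; trans = λ {x} {y} {z} → ≈-trans {x} {y} {z}
              }
            ; ∙-cong = λ {x} {y} {u} {v} → +-cong {x} {y} {u} {v}
            }
          ; assoc = λ x y z → ≈ℝ⇒≈ {(x +ℝ y) +ℝ z} {x +ℝ (y +ℝ z)} (A.assoc x y z)
          }
        ; identity =
            (λ x → ≈ℝ⇒≈ {constℝ 0ℚ +ℝ x} {x} (A.identityˡ x))
          , (λ x → ≈ℝ⇒≈ {x +ℝ constℝ 0ℚ} {x} (A.identityʳ x))
        }
      ; inverse =
          (λ x → ≈ℝ⇒≈ { -ℝ x +ℝ x} {constℝ 0ℚ} (A.inverseˡ x))
        , (λ x → ≈ℝ⇒≈ {x +ℝ -ℝ x} {constℝ 0ℚ} (A.inverseʳ x))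
      ; ⁻¹-cong = λ {x} {y} → -‿cong {x} {y}
      }
    ; comm = λ x y → ≈ℝ⇒≈ {x +ℝ y} {y +ℝ x} (A.comm x y)
    }
  }
  where module A = AbelianGroup ℝ-+-abelianGroup

S¹-setoid : Setoid 0ℓ 0ℓ
S¹-setoid = AbelianGroup.setoid S¹-abelianGroup

S¹ : Set
S¹ = Setoid.Carrier S¹-setoid

-- O(2) is described through its faithful action on the circle, so two
-- elements are the same when they act in the same way; in particular
-- τ a and τ (a + ½) are the same element.

data O₂ : Set where
  σ : S¹ → O₂
  τ : S¹ → O₂

act : O₂ → S¹ → S¹
act (σ a) x = x +ℝ a
act (τ a) x = -ℝ x +ℝ (a +ℝ a)

IsIdentity : O₂ → Set
IsIdentity γ = ∀ x → act γ x ≈ x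

-- A subset of a setoid must be closed under its equality.

record Subset : Set₁ where
  field
    mem  : Pred S¹ 0ℓ
    resp : mem Respects _≈_

open Subset public

-- The elements satisfying a predicate, compared as points of the circle.
⟪_⟫ : Pred S¹ 0ℓ → Setoid 0ℓ 0ℓ
⟪ A ⟫ = On.setoid {B = Σ S¹ A} S¹-setoid proj₁

HasCardinality : Subset → ℕ → Set
HasCardinality W n = Bijection (≡.setoid (Fin n)) ⟪ mem W ⟫

data Color : Set where
  red blue : Color

Coloring : Set
Coloring = S¹-setoid ⟶ₛ ≡.setoid Color

Precoloring : Subset → Set
Precoloring W = ⟪ (λ x → x ∉ mem W) ⟫ ⟶ₛ ≡.setoid Color

Extends : ∀ {W} → Coloring → Precoloring W → Set
Extends {W} c c₀ = ∀ x (x∉W : x ∉ mem W) → c ⟨$⟩ x ≡ c₀ ⟨$⟩ (x , x∉W)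

Preserves : O₂ → Coloring → Set
Preserves γ c = ∀ x → c ⟨$⟩ act γ x ≡ c ⟨$⟩ x

Distinguishing : Coloring → Set
Distinguishing c = ¬ (∃[ γ ] ¬ IsIdentity γ × Preserves γ c)

TrivialPointwiseStabilizer : Subset → Set
TrivialPointwiseStabilizer W =
  ∀ γ → (∀ w → w ∈ mem W → act γ w ≈ w) → IsIdentity γ

-- The trivial stabilizer is the standing condition under which P is
-- considered.  Classically it follows from the second component: extend
-- a constant precoloring.
P : Subset → Set
P W = TrivialPointwiseStabilizer W
    × ((c₀ : Precoloring W) → ∃[ c ] Extends {W} c c₀ × Distinguishing c)

image : (S¹ → S¹) → Pred S¹ 0ℓ → Pred S¹ 0ℓ
image f A y = ∃[ x ] x ∈ A × f x ≈ y

infixl 6 _∖_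
_∖_ : Subset → S¹ → Pred S¹ 0ℓ
(W ∖ w) x = x ∈ mem W × ¬ (x ≈ w)

R : Subset → Set
R W = ∃[ w₀ ] w₀ ∈ mem W × Empty (image (act (τ w₀)) (W ∖ w₀) ∩ mem W)

{-# OPTIONS --safe #-}

-- Put w₀ at the origin.  Colour 0 red and each of the other three points of W
-- opposite to its mirror image under x ↦ -x, which lies outside W; call the
-- result f and let E be the set of blue points with red mirror image.  If f and
-- the colouring with 0 recoloured blue both have symmetries, these must be
-- reflections x ↦ r - x and x ↦ s - x, and with u = r - s the set E behaves like
-- the progression u, 2u, 3u, …: it contains u, is closed under subtracting u
-- except at u, and under adding u except at one point at most.  Recolouring
-- p ∈ W like its mirror image deletes one point ±p from E, and the remainder must
-- be such a progression again, which forces the deleted point to be u or the last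
-- point of E.  Three distinct points cannot all be one of these two.
module Submission where

open import Algebra.Bundles using (AbelianGroup)
import Algebra.Properties.AbelianGroup as AbelianGroupProperties
open import Axiom.ExcludedMiddle using (ExcludedMiddle)
open import Data.Empty using (⊥)
open import Data.Fin.Base using (Fin; zero; suc; punchIn; _<_)
open import Data.Fin.Properties using (pigeonhole; punchIn-injective; punchInᵢ≢i; <⇒≢)
open import Data.Nat.Base using (s≤s; z≤n)
open import Data.Product.Base using (∃-syntax; _×_; _,_; proj₁; proj₂)
open import Data.Sum.Base using (_⊎_; inj₁; inj₂)
open import Defs using (Color; red; blue)
open import Function.Base using (_∘_)
open import Level using (0ℓ; _⊔_)
open import Relation.Binary.Definitions using (Decidable)
import Relation.Binary.PropositionalEquality as ≡
open ≡ using (_≡_; _≢_)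
open import Relation.Nullary.Decidable using (Dec; yes; no; decidable-stable)
open import Relation.Nullary.Negation using (¬_; contradiction)
open import Relation.Unary using (Pred)

-- Symmetries of two-colourings of an abelian group

module _ {a ℓ} (G : AbelianGroup a ℓ) (_≟_ : Decidable (AbelianGroup._≈_ G)) where

  open AbelianGroup G
  open AbelianGroupProperties G
  open import Relation.Binary.Reasoning.Setoid setoid

  Congruent : (Carrier → Color) → Set (a ⊔ ℓ)
  Congruent f = ∀ {x y} → x ≈ y → f x ≡ f y

  data Symmetry (f : Carrier → Color) : Set (a ⊔ ℓ) where
    translation : ∀ t → ¬ t ≈ ε → (∀ x → f (x ∙ t) ≡ f x) → Symmetry f
    reflection  : ∀ r → (∀ x → f (r - x) ≡ f x) → Symmetry f

  Skew : (Carrier → Color) → Pred Carrier 0ℓ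
  Skew f x = f x ≡ blue × f (x ⁻¹) ≡ red

  -- `last` is merely the one point where `ascend` may fail. It need not lie in `E`, so a
  -- progression without an end is covered too.
  record ProgressionFrom (E : Pred Carrier 0ℓ) (t : Carrier) : Set (a ⊔ ℓ) where
    field
      first   : E t
      descend : ∀ {x} → E x → ¬ x ≈ t → E (x - t)
      last     : Carrier
      ascend  : ∀ {x} → E x → ¬ x ≈ last → E (x ∙ t)

  private
    red≢blue : red ≢ blue
    red≢blue ()

    x-0≈x : ∀ x → x - ε ≈ x
    x-0≈x x = trans (∙-congˡ ε⁻¹≈ε) (identityʳ x)

    x-[y-z]≈z+[x-y] : ∀ x y z → x - (y - z) ≈ z ∙ (x - y)
    x-[y-z]≈z+[x-y] x y z = begin
      x - (y - z)   ≈⟨ ∙-congˡ (⁻¹-anti-homo‿- y z) ⟩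
      x ∙ (z - y)   ≈⟨ assoc x z (y ⁻¹) ⟨
      x ∙ z - y     ≈⟨ ∙-congʳ (comm x z) ⟩
      z ∙ x - y     ≈⟨ assoc z x (y ⁻¹) ⟩
      z ∙ (x - y)   ∎

    x-[x+y]≈-y : ∀ x y → x - x ∙ y ≈ y ⁻¹
    x-[x+y]≈-y x y = begin
      x - x ∙ y           ≈⟨ ∙-congˡ (⁻¹-∙-comm x y) ⟨
      x ∙ (x ⁻¹ ∙ y ⁻¹)   ≈⟨ \\-leftDividesˡ x (y ⁻¹) ⟩
      y ⁻¹                ∎

    x+[y-x]≈y : ∀ x y → x ∙ (y - x) ≈ y
    x+[y-x]≈y x y = trans (comm x (y - x)) (//-rightDividesˡ x y)

    x-y-x≈-y : ∀ x y → x - y - x ≈ y ⁻¹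
    x-y-x≈-y x y = xyx⁻¹≈y x (y ⁻¹)

    ⁻¹≈ε⇒≈ε : ∀ {x} → x ⁻¹ ≈ ε → x ≈ ε
    ⁻¹≈ε⇒≈ε -x≈ε = ⁻¹-injective (trans -x≈ε (sym ε⁻¹≈ε))

  Skew-resp : ∀ {f} → Congruent f → ∀ {x y} → x ≈ y → Skew f x → Skew f y
  Skew-resp cong x≈y (fx , f-x) =
    ≡.trans (cong (sym x≈y)) fx , ≡.trans (cong (⁻¹-cong (sym x≈y))) f-x

  Skew-asym : ∀ f {x} → Skew f x → ¬ Skew f (x ⁻¹)
  Skew-asym _ (_ , f-x) (f-x′ , _) = red≢blue (≡.trans (≡.sym f-x) f-x′)

  Skew⇒≉ε : ∀ {f} → Congruent f → ∀ {x} → Skew f x → ¬ x ≈ ε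
  Skew⇒≉ε {f} cong Ex x≈ε = Skew-asym f Ex
    (Skew-resp cong (trans x≈ε (sym (trans (⁻¹-cong x≈ε) ε⁻¹≈ε))) Ex)

  -- Colourings that differ only at the origin

  module _ {f g : Carrier → Color} (f-cong : Congruent f) (g-cong : Congruent g)
           (fε≢gε : f ε ≢ g ε) (f≡g : ∀ {x} → ¬ x ≈ ε → f x ≡ g x) where

    -- Reaching `t ∙ u` through `t` gives it the colour `f ε`, and reaching it through `u` gives it
    -- `g ε`. If `t ∙ u` is itself the origin, the first route alone yields `g ε ≡ f ε`.
    ¬translation-translation : ∀ {t u} → ¬ t ≈ ε → ¬ u ≈ ε →
      (∀ x → f (x ∙ t) ≡ f x) → ¬ (∀ x → g (x ∙ u) ≡ g x)
    ¬translation-translation {t} {u} t≉ε u≉ε f-inv g-inv with (t ∙ u) ≟ ε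
    ... | yes t+u≈ε = fε≢gε (≡.trans (≡.sym g[t+u]) (g-cong t+u≈ε))
      where
      g[t+u] : g (t ∙ u) ≡ f ε
      g[t+u] = ≡.trans (g-inv t) (≡.trans (≡.sym (f≡g t≉ε))
        (≡.trans (f-cong (sym (identityˡ t))) (f-inv ε)))
    ... | no t+u≉ε = fε≢gε (≡.trans (≡.sym f[t+u]) (≡.trans (f-cong (comm t u))
      (≡.trans (f-inv u) (≡.trans (f≡g u≉ε)
        (≡.trans (g-cong (sym (identityˡ u))) (g-inv ε))))))
      where
      f[t+u] : f (t ∙ u) ≡ f ε
      f[t+u] = ≡.trans (f≡g t+u≉ε) (≡.trans (g-inv t) (≡.trans (≡.sym (f≡g t≉ε))
        (≡.trans (f-cong (sym (identityˡ t))) (f-inv ε))))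

    -- If `s` is not the origin, the path `ε`, `s`, `s ∙ t`, `t ⁻¹` (reflect, translate, reflect)
    -- carries the colour `g ε` to `t ⁻¹`, whereas a single translation from `t ⁻¹` to `ε` gives it
    -- `f ε`.
    translation-reflection⇒centre≈ε : ∀ {t s} → ¬ t ≈ ε →
      (∀ x → f (x ∙ t) ≡ f x) → (∀ x → g (s - x) ≡ g x) → s ≈ ε
    translation-reflection⇒centre≈ε {t} {s} t≉ε f-inv g-inv =
      decidable-stable (s ≟ ε) λ s≉ε →
      let gs : g s ≡ g ε
          gs = ≡.trans (g-cong (sym (x-0≈x s))) (g-inv ε)
          f[s+t] : f (s ∙ t) ≡ g ε
          f[s+t] = ≡.trans (f-inv s) (≡.trans (f≡g s≉ε) gs)
          s+t≉ε : ¬ s ∙ t ≈ ε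
          s+t≉ε s+t≈ε = fε≢gε (≡.trans (f-cong (sym s+t≈ε)) f[s+t])
          g[-t] : g (t ⁻¹) ≡ g ε
          g[-t] = ≡.trans (g-cong (sym (x-[x+y]≈-y s t)))
            (≡.trans (g-inv (s ∙ t)) (≡.trans (≡.sym (f≡g s+t≉ε)) f[s+t]))
          f[-t] : f (t ⁻¹) ≡ f ε
          f[-t] = ≡.trans (≡.sym (f-inv (t ⁻¹))) (f-cong (inverseˡ t))
      in fε≢gε (≡.trans (≡.sym f[-t]) (≡.trans (f≡g (t≉ε ∘ ⁻¹≈ε⇒≈ε)) g[-t]))

  -- Progressions of skew points

  module _ {f g : Carrier → Color} (f-cong : Congruent f) (g-cong : Congruent g)
           (fε : f ε ≡ red) (gε : g ε ≡ blue) (f≡g : ∀ {x} → ¬ x ≈ ε → f x ≡ g x) where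

    -- The composite of the two reflections is the translation by r - s.  It
    -- preserves f except for the steps leaving ε and s.
    two-reflections⇒progression : ∀ {r s} → ¬ r ≈ ε → ¬ s ≈ ε →
      (∀ x → f (r - x) ≡ f x) → (∀ x → g (s - x) ≡ g x) → ProgressionFrom (Skew f) (r - s)
    two-reflections⇒progression {r} {s} r≉ε s≉ε f-refl g-refl = record
      { first = ft , f[-t]
      ; descend = descend
      ; last = proj₁ top
      ; ascend = proj₂ top
      }
      where
      t = r - s
      E = Skew f

      -- Most of the inequalities that `shift` requires come from a difference in colour, mainly
      -- from `ε` and `r` being red and `s` blue.
      clash : ∀ {x y} → f x ≡ red → f y ≡ blue → ¬ x ≈ y
      clash fx fy x≈y = red≢blue (≡.trans (≡.sym fx) (≡.trans (f-cong x≈y) fy))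

      fr : f r ≡ red
      fr = ≡.trans (f-cong (sym (x-0≈x r))) (≡.trans (f-refl ε) fε)

      fs : f s ≡ blue
      fs = ≡.trans (f≡g s≉ε) (≡.trans (g-cong (sym (x-0≈x s))) (≡.trans (g-refl ε) gε))

      shift : ∀ {x} → ¬ x ≈ ε → ¬ x ≈ s → f (x ∙ t) ≡ f x
      shift {x} x≉ε x≉s = ≡.trans (f-cong (sym (x-[y-z]≈z+[x-y] r s x)))
        (≡.trans (f-refl (s - x)) (≡.trans (f≡g s-x≉ε)
        (≡.trans (g-refl x) (≡.sym (f≡g x≉ε)))))
        where
        s-x≉ε : ¬ s - x ≈ ε
        s-x≉ε eq = x≉s (sym (x∙y⁻¹≈ε⇒x≈y s x eq))

      ft : f t ≡ blue
      ft = ≡.trans (f-refl s) fs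

      -- `t` is blue, being the `f`-reflection of `s`, while `ε` is red.
      -t≉ε : ¬ t ⁻¹ ≈ ε
      -t≉ε -t≈ε = clash fε ft (sym (⁻¹≈ε⇒≈ε -t≈ε))

      f[-t] : f (t ⁻¹) ≡ red
      f[-t] = ≡.trans (f≡g -t≉ε) (≡.trans (g-cong (⁻¹-anti-homo‿- r s))
        (≡.trans (g-refl r) (≡.trans (≡.sym (f≡g r≉ε)) fr)))

      s+t≈r : s ∙ t ≈ r
      s+t≈r = x+[y-x]≈y s r

      -r+t≈-s : r ⁻¹ ∙ t ≈ s ⁻¹
      -r+t≈-s = \\-leftDividesʳ r (s ⁻¹)

      descend : ∀ {x} → E x → ¬ x ≈ t → E (x - t)
      descend {x} (fx , f-x) x≉t =
        ≡.trans (≡.sym (shift x-t≉ε x-t≉s)) (≡.trans (f-cong (//-rightDividesˡ t x)) fx) ,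
        ≡.trans (f-cong (trans (⁻¹-anti-homo‿- x t) (comm t (x ⁻¹))))
          (≡.trans (shift (clash fε fx ∘ sym ∘ ⁻¹≈ε⇒≈ε) (clash f-x fs)) f-x)
        where
        x-t≉ε : ¬ x - t ≈ ε
        x-t≉ε eq = x≉t (x∙y⁻¹≈ε⇒x≈y x t eq)
        x-t≉s : ¬ x - t ≈ s
        x-t≉s eq = clash fr fx (begin
          r          ≈⟨ s+t≈r ⟨
          s ∙ t      ≈⟨ ∙-congʳ eq ⟨
          (x - t) ∙ t  ≈⟨ //-rightDividesˡ t x ⟩
          x          ∎)

      -- Two exceptions appear at first: `s`, where `shift` fails at `x`, and `r ⁻¹`, where it fails
      -- at the mirror image of `x ∙ t`.
      ascend : ∀ {x} → E x → ¬ x ≈ s → ¬ x ≈ r ⁻¹ → E (x ∙ t)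
      ascend {x} (fx , f-x) x≉s x≉-r =
        ≡.trans (shift (clash fε fx ∘ sym) x≉s) fx ,
        ≡.trans (≡.sym (shift -[x+t]≉ε -[x+t]≉s)) (≡.trans (f-cong -[x+t]+t≈-x) f-x)
        where
        -[x+t]+t≈-x : (x ∙ t) ⁻¹ ∙ t ≈ x ⁻¹
        -[x+t]+t≈-x = trans (∙-congʳ (sym (⁻¹-∙-comm x t))) (//-rightDividesˡ t (x ⁻¹))
        -[x+t]≉ε : ¬ (x ∙ t) ⁻¹ ≈ ε
        -[x+t]≉ε eq = clash f[-t] fx (sym (inverseˡ-unique x t (⁻¹≈ε⇒≈ε eq)))
        -[x+t]≉s : ¬ (x ∙ t) ⁻¹ ≈ s
        -[x+t]≉s eq = x≉-r (sym (⁻¹-selfInverse (begin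
          x ⁻¹              ≈⟨ -[x+t]+t≈-x ⟨
          (x ∙ t) ⁻¹ ∙ t    ≈⟨ ∙-congʳ eq ⟩
          s ∙ t             ≈⟨ s+t≈r ⟩
          r                 ∎)))

      -- If the two exceptions were distinct points of `E`, `shift` would carry the blue `r ⁻¹` to
      -- the red `s ⁻¹`.
      s∈E∧-r∈E⇒-r≈s : E s → E (r ⁻¹) → r ⁻¹ ≈ s
      s∈E∧-r∈E⇒-r≈s (_ , f-s) (f-r , _) = decidable-stable ((r ⁻¹) ≟ s) λ -r≉s →
        clash (≡.trans (≡.sym (shift (r≉ε ∘ ⁻¹≈ε⇒≈ε) -r≉s)) (≡.trans (f-cong -r+t≈-s) f-s)) f-r refl

      _≟ᶜ_ : ∀ (k l : Color) → Dec (k ≡ l)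
      red  ≟ᶜ red  = yes ≡.refl
      red  ≟ᶜ blue = no λ ()
      blue ≟ᶜ red  = no λ ()
      blue ≟ᶜ blue = yes ≡.refl

      -- Since `s` is blue, it lies in `E` exactly when `s ⁻¹` is red. In that case it is the only
      -- exception; otherwise only `r ⁻¹` can be one.
      top : ∃[ e ] (∀ {x} → E x → ¬ x ≈ e → E (x ∙ t))
      top with f (s ⁻¹) ≟ᶜ red
      ... | yes f-s = s , λ Ex x≉s → ascend Ex x≉s λ x≈-r →
              x≉s (trans x≈-r (s∈E∧-r∈E⇒-r≈s (fs , f-s) (Skew-resp f-cong x≈-r Ex)))
      ... | no f-s≢red = r ⁻¹ , λ Ex x≉-r → ascend Ex
              (λ x≈s → f-s≢red (proj₂ (Skew-resp f-cong x≈s Ex))) x≉-r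

    -- Two translations are incompatible, and a translation paired with a reflection forces that
    -- reflection to be inversion. The point `y` witnesses that neither colouring is invariant under
    -- inversion, so only two reflections remain.
    symmetries⇒progression : ∀ {y} → f (y ⁻¹) ≢ f y → Symmetry f → Symmetry g →
      ∃[ t ] ProgressionFrom (Skew f) t
    symmetries⇒progression {y} f-y≢fy = λ where
        (translation t t≉ε f-inv) (translation u u≉ε g-inv) → contradiction g-inv
          (¬translation-translation f-cong g-cong fε≢gε f≡g t≉ε u≉ε f-inv)
        (translation t t≉ε f-inv) (reflection s g-refl) → contradiction
          (translation-reflection⇒centre≈ε f-cong g-cong fε≢gε f≡g t≉ε f-inv g-refl) (s≉ε g-refl)
        (reflection r f-refl) (translation u u≉ε g-inv) → contradiction
          (translation-reflection⇒centre≈ε g-cong f-cong (fε≢gε ∘ ≡.sym) (λ x≉ε → ≡.sym (f≡g x≉ε))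
            u≉ε g-inv f-refl)
          (r≉ε f-refl)
        (reflection r f-refl) (reflection s g-refl) →
          r - s , two-reflections⇒progression (r≉ε f-refl) (s≉ε g-refl) f-refl g-refl
      where
      fε≢gε : f ε ≢ g ε
      fε≢gε eq = red≢blue (≡.trans (≡.sym fε) (≡.trans eq gε))

      centred : ∀ {h r} → Congruent h → (∀ x → h (r - x) ≡ h x) → r ≈ ε → h (y ⁻¹) ≡ h y
      centred h-cong h-refl r≈ε =
        ≡.trans (h-cong (sym (trans (∙-congʳ r≈ε) (identityˡ _)))) (h-refl y)

      y≉ε : ¬ y ≈ ε
      y≉ε y≈ε = f-y≢fy (f-cong (trans (⁻¹-cong y≈ε) (trans ε⁻¹≈ε (sym y≈ε))))

      r≉ε : ∀ {r} → (∀ x → f (r - x) ≡ f x) → ¬ r ≈ ε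
      r≉ε f-refl r≈ε = f-y≢fy (centred f-cong f-refl r≈ε)

      s≉ε : ∀ {s} → (∀ x → g (s - x) ≡ g x) → ¬ s ≈ ε
      s≉ε g-refl s≈ε = f-y≢fy (≡.trans (f≡g (y≉ε ∘ ⁻¹≈ε⇒≈ε))
        (≡.trans (centred g-cong g-refl s≈ε) (≡.sym (f≡g y≉ε))))

  -- Suppose `p` is neither `last` nor `u`. With `v ≈ u`, descending from `p ∙ u` in `X` would
  -- return the deleted `p`. Descending from `v` by `u` and then by `v` would reach `u ⁻¹`, which
  -- asymmetry forbids, so the first descent must hit `p`, that is `v - u ≈ p`. But then `u`
  -- descends in `X` to `u - v ≈ p ⁻¹`, again against asymmetry.
  removable⇒endpoint : ∀ {f} → Congruent f → ∀ {u} (E : ProgressionFrom (Skew f) u) →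
    ∀ {X v p} → ProgressionFrom X v →
    (∀ {x} → X x → Skew f x × ¬ x ≈ p) → (∀ {x} → Skew f x → ¬ x ≈ p → X x) →
    Skew f p → ¬ p ≈ ProgressionFrom.last E → p ≈ u
  removable⇒endpoint {f} f-cong {u} E {X} {v} {p} X-prog X⊆ ⊆X Ep p≉last =
    decidable-stable (p ≟ u) λ p≉u → impossible p≉u
    where
    open ProgressionFrom E
    module X = ProgressionFrom X-prog

    u≉ε : ¬ u ≈ ε
    u≉ε = Skew⇒≉ε f-cong first

    v≉u : ¬ v ≈ u
    v≉u v≈u = proj₂ (X⊆ (X.descend p+u∈X p+u≉v)) p+u-v≈p
      where
      p+u∈X : X (p ∙ u)
      p+u∈X = ⊆X (ascend Ep p≉last) (u≉ε ∘ identityʳ-unique p u)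
      p+u≉v : ¬ p ∙ u ≈ v
      p+u≉v eq = Skew⇒≉ε f-cong Ep (identityˡ-unique p u (trans eq v≈u))
      p+u-v≈p : p ∙ u - v ≈ p
      p+u-v≈p = trans (∙-congˡ (⁻¹-cong v≈u)) (//-rightDividesʳ u p)

    v-u≈p : v - u ≈ p
    v-u≈p = decidable-stable ((v - u) ≟ p) λ v-u≉p →
      Skew-asym f first (Skew-resp f-cong (x-y-x≈-y v u) (proj₁ (X⊆
        (X.descend (⊆X (descend (proj₁ (X⊆ X.first)) v≉u) v-u≉p)
          λ eq → u≉ε (⁻¹≈ε⇒≈ε (identityʳ-unique v (u ⁻¹) eq))))))

    impossible : ¬ p ≈ u → ⊥
    impossible p≉u = Skew-asym f Ep (Skew-resp f-cong u-v≈-p (proj₁ (X⊆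
      (X.descend (⊆X first (p≉u ∘ sym)) (v≉u ∘ sym)))))
      where
      u-v≈-p : u - v ≈ p ⁻¹
      u-v≈-p = trans (sym (⁻¹-anti-homo‿- v u)) (⁻¹-cong v-u≈p)

  -- Recolouring single points

  update : (Carrier → Color) → Carrier → Color → Carrier → Color
  update f p k x with x ≟ p
  ... | yes _ = k
  ... | no  _ = f x

  update-≈ : ∀ f k {p x} → x ≈ p → update f p k x ≡ k
  update-≈ f k {p} {x} x≈p with x ≟ p
  ... | yes _  = ≡.refl
  ... | no x≉p = contradiction x≈p x≉p

  update-≉ : ∀ f k {p x} → ¬ x ≈ p → update f p k x ≡ f x
  update-≉ f k {p} {x} x≉p with x ≟ p
  ... | yes x≈p = contradiction x≈p x≉p
  ... | no _    = ≡.refl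

  update-cong : ∀ {f} p k → Congruent f → Congruent (update f p k)
  update-cong {f} p k f-cong {x} {y} x≈y with y ≟ p
  ... | yes y≈p = update-≈ f k (trans x≈y y≈p)
  ... | no y≉p  = ≡.trans (update-≉ f k (y≉p ∘ trans (sym x≈y))) (f-cong x≈y)

  -- Recolouring the origin and three skew points

  module _ {f : Carrier → Color} (f-cong : Congruent f) (p : Fin 3 → Carrier)
           (p≉ε : ∀ i → ¬ p i ≈ ε)
           (p-injective : ∀ {i j} → p i ≈ p j → i ≡ j)
           (p≉-p : ∀ i j → ¬ p i ≈ p j ⁻¹)
           (fε : f ε ≡ red)
           (f-skew : ∀ i → f (p i ⁻¹) ≢ f (p i)) where

    -- Eight colourings are used: `f`, its three versions with one `p i` recoloured, and each of
    -- these four with `ε` turned blue. Each of the four pairs yields a progression, and comparing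
    -- them confines three distinct points to two positions.
    symmetric-recolourings⇒⊥ :
      (∀ g → Congruent g → (∀ x → ¬ x ≈ ε → (∀ i → ¬ x ≈ p i) → g x ≡ f x) → Symmetry g) → ⊥
    symmetric-recolourings⇒⊥ sym-g = p′-collision (pigeonhole (s≤s (s≤s (s≤s z≤n))) side)
      where
      progression : ∀ g → Congruent g → g ε ≡ red →
        (∀ x → ¬ x ≈ ε → (∀ i → ¬ x ≈ p i) → g x ≡ f x) →
        ∀ {y} → g (y ⁻¹) ≢ g y → ∃[ t ] ProgressionFrom (Skew g) t
      progression g g-cong gε g≡f g-skew = symmetries⇒progression g-cong
        (update-cong ε blue g-cong) gε (update-≈ g blue refl)
        (λ x≉ε → ≡.sym (update-≉ g blue x≉ε)) g-skew (sym-g g g-cong g≡f)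
        (sym-g (update g ε blue) (update-cong ε blue g-cong)
          λ x x≉ε x≉p → ≡.trans (update-≉ g blue x≉ε) (g≡f x x≉ε x≉p))

      f-progression : ∃[ u ] ProgressionFrom (Skew f) u
      f-progression = progression f f-cong fε (λ _ _ _ → ≡.refl) (f-skew zero)

      u = proj₁ f-progression
      open ProgressionFrom (proj₂ f-progression) using (last)

      -- The colours at `p i` and its inverse differ, so one of the two points is skew.
      oriented : ∀ i → ∃[ q ] Skew f q × (q ≈ p i ⊎ q ≈ p i ⁻¹)
      oriented i with f (p i) in eq | f (p i ⁻¹) in eq⁻¹
      ... | red  | red  = contradiction (≡.trans eq⁻¹ (≡.sym eq)) (f-skew i)
      ... | red  | blue = p i ⁻¹ , (eq⁻¹ , ≡.trans (f-cong (⁻¹-involutive (p i))) eq) , inj₂ refl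
      ... | blue | red  = p i , (eq , eq⁻¹) , inj₁ refl
      ... | blue | blue = contradiction (≡.trans eq⁻¹ (≡.sym eq)) (f-skew i)

      p′ : Fin 3 → Carrier
      p′ i = proj₁ (oriented i)

      p′-injective : ∀ {i j} → p′ i ≈ p′ j → i ≡ j
      p′-injective {i} {j} eq with oriented i | oriented j
      ... | _ , _ , inj₁ qi | _ , _ , inj₁ qj = p-injective (trans (sym qi) (trans eq qj))
      ... | _ , _ , inj₁ qi | _ , _ , inj₂ qj = contradiction (trans (sym qi) (trans eq qj)) (p≉-p i j)
      ... | _ , _ , inj₂ qi | _ , _ , inj₁ qj =
        contradiction (trans (sym qj) (trans (sym eq) qi)) (p≉-p j i)
      ... | _ , _ , inj₂ qi | _ , _ , inj₂ qj =
        p-injective (⁻¹-injective (trans (sym qi) (trans eq qj)))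

      -- Once `p i` is coloured like its inverse, another `p j` must witness that the colouring is
      -- not invariant under inversion.
      other : ∀ i → ∃[ j ] i ≢ j
      other zero    = suc zero , λ ()
      other (suc _) = zero , λ ()

      module _ (i : Fin 3) where
        q = p′ i
        g = update f (p i) (f (p i ⁻¹))

        g≡f : ∀ {x} → ¬ x ≈ p i → g x ≡ f x
        g≡f = update-≉ f (f (p i ⁻¹))

        g-cong : Congruent g
        g-cong = update-cong (p i) (f (p i ⁻¹)) f-cong

        g-symmetric : ∀ {x} → x ≈ p i ⊎ x ≈ p i ⁻¹ → g (x ⁻¹) ≡ g x
        g-symmetric {x} x≈±p = from x≈±p
          where
          at-p : g (p i ⁻¹) ≡ g (p i)
          at-p = ≡.trans (g≡f (p≉-p i i ∘ sym)) (≡.sym (update-≈ f _ refl))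
          from : x ≈ p i ⊎ x ≈ p i ⁻¹ → g (x ⁻¹) ≡ g x
          from (inj₁ x≈p)  = ≡.trans (g-cong (⁻¹-cong x≈p)) (≡.trans at-p (g-cong (sym x≈p)))
          from (inj₂ x≈-p) = ≡.trans (g-cong (trans (⁻¹-cong x≈-p) (⁻¹-involutive (p i))))
            (≡.trans (≡.sym at-p) (g-cong (sym x≈-p)))

        g-progression : ∃[ v ] ProgressionFrom (Skew g) v
        g-progression with other i
        ... | j , i≢j = progression g g-cong (≡.trans (g≡f (p≉ε i ∘ sym)) fε)
          (λ x _ x≉p → g≡f (x≉p i)) {p j} λ eq → f-skew j
            (≡.trans (≡.sym (g≡f (p≉-p i j ∘ sym)))
              (≡.trans eq (g≡f (i≢j ∘ p-injective ∘ sym))))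

        q≈±p : q ≈ p i ⊎ q ≈ p i ⁻¹
        q≈±p = proj₂ (proj₂ (oriented i))

        q∈E : Skew f q
        q∈E = proj₁ (proj₂ (oriented i))

        ±q : ∀ {x} → x ≈ p i ⊎ x ≈ p i ⁻¹ → x ≈ q ⊎ x ≈ q ⁻¹
        ±q x≈±p with q≈±p | x≈±p
        ... | inj₁ q≈p  | inj₁ x≈p  = inj₁ (trans x≈p (sym q≈p))
        ... | inj₁ q≈p  | inj₂ x≈-p = inj₂ (trans x≈-p (⁻¹-cong (sym q≈p)))
        ... | inj₂ q≈-p | inj₁ x≈p  = inj₂ (trans x≈p (sym (⁻¹-selfInverse (sym q≈-p))))
        ... | inj₂ q≈-p | inj₂ x≈-p = inj₁ (trans x≈-p (sym q≈-p))

        -x≉p : ∀ {x} → ¬ x ≈ p i ⁻¹ → ¬ x ⁻¹ ≈ p i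
        -x≉p x≉-p eq = x≉-p (sym (⁻¹-selfInverse eq))

        -- Together with `⇒skew-g` this identifies `Skew g` with `Skew f` less the point `q`; the
        -- inverse of `q` was never skew for `f`.
        skew-g⇒ : ∀ {x} → Skew g x → Skew f x × ¬ x ≈ q
        skew-g⇒ {x} (gx , g-x) =
          (≡.trans (≡.sym (g≡f (x≉±p ∘ inj₁))) gx ,
           ≡.trans (≡.sym (g≡f (-x≉p (x≉±p ∘ inj₂)))) g-x) ,
          λ x≈q → x≉±p (±p x≈q)
          where
          x≉±p : ¬ (x ≈ p i ⊎ x ≈ p i ⁻¹)
          x≉±p x≈±p = red≢blue (≡.trans (≡.sym g-x) (≡.trans (g-symmetric x≈±p) gx))
          ±p : x ≈ q → x ≈ p i ⊎ x ≈ p i ⁻¹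
          ±p x≈q with q≈±p
          ... | inj₁ q≈p  = inj₁ (trans x≈q q≈p)
          ... | inj₂ q≈-p = inj₂ (trans x≈q q≈-p)

        ⇒skew-g : ∀ {x} → Skew f x → ¬ x ≈ q → Skew g x
        ⇒skew-g {x} Ex@(fx , f-x) x≉q =
          ≡.trans (g≡f (x≉±p ∘ inj₁)) fx , ≡.trans (g≡f (-x≉p (x≉±p ∘ inj₂))) f-x
          where
          x≉±p : ¬ (x ≈ p i ⊎ x ≈ p i ⁻¹)
          x≉±p x≈±p with ±q x≈±p
          ... | inj₁ x≈q  = x≉q x≈q
          ... | inj₂ x≈-q = Skew-asym f q∈E (Skew-resp f-cong x≈-q Ex)

        q≈last⊎q≈u : q ≈ last ⊎ q ≈ u
        q≈last⊎q≈u with q ≟ last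
        ... | yes q≈last = inj₁ q≈last
        ... | no q≉last  = inj₂ (removable⇒endpoint f-cong (proj₂ f-progression)
          (proj₂ g-progression) skew-g⇒ ⇒skew-g q∈E q≉last)

      side : Fin 3 → Fin 2
      side i with q≈last⊎q≈u i
      ... | inj₁ _ = zero
      ... | inj₂ _ = suc zero

      same-side : ∀ i j → side i ≡ side j → p′ i ≈ p′ j
      same-side i j eq with q≈last⊎q≈u i | q≈last⊎q≈u j
      same-side i j eq | inj₁ a | inj₁ b = trans a (sym b)
      same-side i j () | inj₁ _ | inj₂ _
      same-side i j () | inj₂ _ | inj₁ _
      same-side i j eq | inj₂ a | inj₂ b = trans a (sym b)

      p′-collision : ¬ (∃[ i ] ∃[ j ] (i < j × side i ≡ side j))
      p′-collision (i , j , i<j , eq) = <⇒≢ i<j (p′-injective (same-side i j eq))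

  -- Mirrors and moving the origin

  mirror : Carrier → Carrier → Carrier
  mirror z x = x ⁻¹ ∙ (z ∙ z)

  -- In coordinates centred at `z` the mirror becomes inversion.
  mirror≈-[x-z]+z : ∀ z x → mirror z x ≈ (x - z) ⁻¹ ∙ z
  mirror≈-[x-z]+z z x = begin
    x ⁻¹ ∙ (z ∙ z)    ≈⟨ assoc (x ⁻¹) z z ⟨
    x ⁻¹ ∙ z ∙ z      ≈⟨ ∙-congʳ (comm (x ⁻¹) z) ⟩
    (z - x) ∙ z       ≈⟨ ∙-congʳ (⁻¹-anti-homo‿- x z) ⟨
    (x - z) ⁻¹ ∙ z    ∎

  mirror-symmetry : ∀ {f} → Congruent f → ∀ z → (∀ x → f (mirror z x) ≡ f x) → Symmetry f
  mirror-symmetry f-cong z inv = reflection (z ∙ z) λ x →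
    ≡.trans (f-cong (comm (z ∙ z) (x ⁻¹))) (inv x)

  -- Conjugating by the translation by `z` fixes translations and turns the reflection with
  -- parameter `r` into the one with parameter `r - z - z`.
  Symmetry-shift : ∀ {g z} → Congruent g → Symmetry (λ x → g (x - z)) → Symmetry g
  Symmetry-shift {g} {z} g-cong (translation t t≉ε inv) = translation t t≉ε λ x →
    ≡.trans (g-cong (sym (begin
      (x ∙ z) ∙ t - z     ≈⟨ ∙-congʳ (assoc x z t) ⟩
      x ∙ (z ∙ t) - z     ≈⟨ ∙-congʳ (∙-congˡ (comm z t)) ⟩
      x ∙ (t ∙ z) - z     ≈⟨ ∙-congʳ (assoc x t z) ⟨
      (x ∙ t) ∙ z - z     ≈⟨ //-rightDividesʳ z (x ∙ t) ⟩
      x ∙ t               ∎)))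
    (≡.trans (inv (x ∙ z)) (g-cong (//-rightDividesʳ z x)))
  Symmetry-shift {g} {z} g-cong (reflection r inv) = reflection (r - z - z) λ x →
    ≡.trans (g-cong (sym (begin
      (r - x ∙ z) - z             ≈⟨ ∙-congʳ (∙-congˡ (trans (⁻¹-cong (comm x z)) (sym (⁻¹-∙-comm z x)))) ⟩
      r ∙ (z ⁻¹ ∙ x ⁻¹) - z       ≈⟨ ∙-congʳ (assoc r (z ⁻¹) (x ⁻¹)) ⟨
      r - z - x - z               ≈⟨ assoc (r - z) (x ⁻¹) (z ⁻¹) ⟩
      (r - z) ∙ (x ⁻¹ ∙ z ⁻¹)     ≈⟨ ∙-congˡ (comm (x ⁻¹) (z ⁻¹)) ⟩
      (r - z) ∙ (z ⁻¹ ∙ x ⁻¹)     ≈⟨ assoc (r - z) (z ⁻¹) (x ⁻¹) ⟨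
      r - z - z - x               ∎)))
    (≡.trans (inv (x ∙ z)) (g-cong (//-rightDividesʳ z x)))

  module _ {m} {W : Pred Carrier m} (W? : ∀ x → Dec (W x)) (W-resp : ∀ {x y} → x ≈ y → W x → W y)
           {z} (z∈W : W z) (mirror∉W : ∀ {x} → W x → ¬ x ≈ z → ¬ W (mirror z x))
           (w : Fin 3 → Carrier) (w∈W : ∀ i → W (w i)) (w≉z : ∀ i → ¬ w i ≈ z)
           (w-injective : ∀ {i j} → w i ≈ w j → i ≡ j)
           (c₀ : ∀ x → ¬ W x → Color)
           (c₀-cong : ∀ {x y} x∉W y∉W → x ≈ y → c₀ x x∉W ≡ c₀ y y∉W) where

    -- In coordinates centred at `z`, build one extension `f` to which the recolouring argument
    -- applies. Any recolouring `g` of `f` at points of `W` pulls back to the extension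
    -- `x ↦ g (x - z)`, whose symmetry is then shifted to `g`.
    symmetric-extensions⇒⊥ :
      (∀ h → Congruent h → (∀ x x∉W → h x ≡ c₀ x x∉W) → Symmetry h) → ⊥
    symmetric-extensions⇒⊥ sym-h = symmetric-recolourings⇒⊥ f-cong p p≉ε
      (λ {i} {j} → w-injective ∘ ∙-cancelʳ (z ⁻¹) (w i) (w j)) p≉-p fε f-skew
      λ g g-cong g≡f → Symmetry-shift g-cong (sym-h (λ x → g (x - z))
        (λ x≈y → g-cong (∙-congʳ x≈y))
        λ x x∉W → ≡.trans
          (g≡f (x - z) (λ eq → x∉W (W-resp (sym (x∙y⁻¹≈ε⇒x≈y x z eq)) z∈W))
            (λ i eq → x∉W (W-resp (sym (∙-cancelʳ (z ⁻¹) x (w i) eq)) (w∈W i))))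
          (f≡value (//-rightDividesˡ z x) (no x∉W) (x ≟ z)))
      where
      flip : Color → Color
      flip red  = blue
      flip blue = red

      k≢flip : ∀ k → k ≢ flip k
      k≢flip red  ()
      k≢flip blue ()

      -- The decisions are arguments, so that `value-cong` can compare values across different
      -- decisions and `f≡value` can put in known ones.
      value : ∀ x → Dec (W x) → Dec (x ≈ z) → Color
      value x (no x∉W)  _        = c₀ x x∉W
      value x (yes _)   (yes _)  = red
      value x (yes x∈W) (no x≉z) = flip (c₀ (mirror z x) (mirror∉W x∈W x≉z))

      value-cong : ∀ {x y} → x ≈ y → ∀ dx dy ex ey → value x dx ex ≡ value y dy ey
      value-cong x≈y (no x∉W)  (no y∉W)  _         _         = c₀-cong x∉W y∉W x≈y
      value-cong x≈y (no x∉W)  (yes y∈W) _         _         = contradiction (W-resp (sym x≈y) y∈W) x∉W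
      value-cong x≈y (yes x∈W) (no y∉W)  _         _         = contradiction (W-resp x≈y x∈W) y∉W
      value-cong x≈y (yes _)   (yes _)   (yes _)   (yes _)   = ≡.refl
      value-cong x≈y (yes _)   (yes _)   (yes x≈z) (no y≉z)  = contradiction (trans (sym x≈y) x≈z) y≉z
      value-cong x≈y (yes _)   (yes _)   (no x≉z)  (yes y≈z) = contradiction (trans x≈y y≈z) x≉z
      value-cong x≈y (yes _)   (yes _)   (no x≉z)  (no y≉z)  =
        ≡.cong flip (c₀-cong _ _ (∙-congʳ (⁻¹-cong x≈y)))

      f : Carrier → Color
      f x = value (x ∙ z) (W? (x ∙ z)) ((x ∙ z) ≟ z)

      f≡value : ∀ {x y} → x ∙ z ≈ y → ∀ dy ey → f x ≡ value y dy ey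
      f≡value {x} x+z≈y dy = value-cong x+z≈y (W? (x ∙ z)) dy ((x ∙ z) ≟ z)

      f-cong : Congruent f
      f-cong {x} {y} x≈y = f≡value (∙-congʳ x≈y) (W? (y ∙ z)) ((y ∙ z) ≟ z)

      p : Fin 3 → Carrier
      p i = w i - z

      p≉ε : ∀ i → ¬ p i ≈ ε
      p≉ε i eq = w≉z i (x∙y⁻¹≈ε⇒x≈y (w i) z eq)

      p≉-p : ∀ i j → ¬ p i ≈ p j ⁻¹
      p≉-p i j eq = mirror∉W (w∈W j) (w≉z j) (W-resp (begin
        w i               ≈⟨ //-rightDividesˡ z (w i) ⟨
        p i ∙ z           ≈⟨ ∙-congʳ eq ⟩
        p j ⁻¹ ∙ z        ≈⟨ mirror≈-[x-z]+z z (w j) ⟨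
        mirror z (w j)    ∎) (w∈W i))

      fε : f ε ≡ red
      fε = f≡value (identityˡ z) (yes z∈W) (yes refl)

      f-skew : ∀ i → f (p i ⁻¹) ≢ f (p i)
      f-skew i eq = k≢flip (c₀ (mirror z (w i)) wi*∉W) (≡.trans (≡.sym f[-p]) (≡.trans eq f[p]))
        where
        wi*∉W : ¬ W (mirror z (w i))
        wi*∉W = mirror∉W (w∈W i) (w≉z i)
        f[-p] : f (p i ⁻¹) ≡ c₀ (mirror z (w i)) wi*∉W
        f[-p] = f≡value (sym (mirror≈-[x-z]+z z (w i))) (no wi*∉W) (_ ≟ z)
        f[p] : f (p i) ≡ flip (c₀ (mirror z (w i)) wi*∉W)
        f[p] = f≡value (//-rightDividesˡ z (w i)) (yes (w∈W i)) (no (w≉z i))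

-- The circle

open import Defs
open import Function.Bundles using (Bijection; Func; _⟨$⟩_)

private
  module S¹ = AbelianGroup S¹-abelianGroup
  module S¹ₚ = AbelianGroupProperties S¹-abelianGroup

theorem2p2p2 : ExcludedMiddle 0ℓ → (W : Subset) → HasCardinality W 4 → R W → P W
theorem2p2p2 em W W≃4 (w₀ , w₀∈W , disjoint) = stabilizer , extension
  where
  open Bijection W≃4 using (to; injective; surjective)

  i₀ : Fin 4
  i₀ = proj₁ (surjective (w₀ , w₀∈W))

  to-i₀≈w₀ : proj₁ (to i₀) ≈ w₀
  to-i₀≈w₀ = proj₂ (surjective (w₀ , w₀∈W)) ≡.refl

  -- `punchIn i₀` skips the index of `w₀`, leaving the other three points of `W`.
  w : Fin 3 → S¹
  w i = proj₁ (to (punchIn i₀ i))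

  w∈W : ∀ i → mem W (w i)
  w∈W i = proj₂ (to (punchIn i₀ i))

  w-injective : ∀ {i j} → w i ≈ w j → i ≡ j
  w-injective {i} {j} eq = punchIn-injective i₀ i j (injective eq)

  w≉w₀ : ∀ i → ¬ w i ≈ w₀
  w≉w₀ i eq = punchInᵢ≢i i₀ i (injective
    (≈-trans {w i} {w₀} {proj₁ (to i₀)} eq (≈-sym {proj₁ (to i₀)} {w₀} to-i₀≈w₀)))

  τ∉W : ∀ {x} → mem W x → ¬ x ≈ w₀ → ¬ mem W (act (τ w₀) x)
  τ∉W {x} x∈W x≉w₀ τx∈W =
    disjoint (act (τ w₀) x) ((x , (x∈W , x≉w₀) , S¹.refl {act (τ w₀) x}) , τx∈W)

  _≟_ : Decidable _≈_
  x ≟ y = em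

  reflect : S¹ → S¹ → S¹
  reflect = mirror S¹-abelianGroup _≟_

  -- Stated up to _≈_ because that relation ignores the Cauchy moduli.
  reflect≈τ : ∀ a x → reflect a x ≈ act (τ a) x
  reflect≈τ a x = S¹.refl {act (τ a) x}

  σ-nonidentity : ∀ {t} → ¬ IsIdentity (σ t) → ¬ t ≈ S¹.ε
  σ-nonidentity {t} σt≢1 t≈0 = σt≢1 λ x → ≈-trans {x +ℝ t} {x +ℝ S¹.ε} {x}
    (+-cong {x} {x} {t} {S¹.ε} (S¹.refl {x}) t≈0) (S¹.identityʳ x)

  stabilizer : TrivialPointwiseStabilizer W
  stabilizer (σ t) fixes x = ≈-trans {x +ℝ t} {x +ℝ S¹.ε} {x}
    (+-cong {x} {x} {t} {S¹.ε} (S¹.refl {x}) (S¹ₚ.identityʳ-unique w₀ t (fixes w₀ w₀∈W)))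
    (S¹.identityʳ x)
  -- A reflection fixing `w₀` has `a +ℝ a ≈ w₀ +ℝ w₀`, hence acts as `τ w₀`. If it also fixed
  -- `w zero`, the mirror image of that point would lie in `W`.
  stabilizer (τ a) fixes = contradiction
    (resp W {w zero} {act (τ w₀) (w zero)} w≈τw (w∈W zero)) (τ∉W (w∈W zero) (w≉w₀ zero))
    where
    a+a≈w₀+w₀ : a +ℝ a ≈ w₀ +ℝ w₀
    a+a≈w₀+w₀ = S¹ₚ.∙-cancelˡ (-ℝ w₀) (a +ℝ a) (w₀ +ℝ w₀)
      (≈-trans {act (τ a) w₀} {w₀} {act (τ w₀) w₀} (fixes w₀ w₀∈W)
        (≈-sym {act (τ w₀) w₀} {w₀} (S¹ₚ.\\-leftDividesʳ w₀ w₀)))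
    w≈τw : w zero ≈ act (τ w₀) (w zero)
    w≈τw = ≈-trans {w zero} {act (τ a) (w zero)} {act (τ w₀) (w zero)}
      (≈-sym {act (τ a) (w zero)} {w zero} (fixes (w zero) (w∈W zero)))
      (+-cong { -ℝ w zero} { -ℝ w zero} {a +ℝ a} {w₀ +ℝ w₀} (S¹.refl { -ℝ w zero}) a+a≈w₀+w₀)

  extension : (c₀ : Precoloring W) → ∃[ c ] Extends {W} c c₀ × Distinguishing c
  -- If no extension is distinguishing, excluded middle extracts an actual symmetry from each one.
  extension c₀ = decidable-stable em λ ¬extension →
    symmetric-extensions⇒⊥ S¹-abelianGroup _≟_ {W = mem W} (λ _ → em)
      (λ {x} {y} → resp W {x} {y}) {w₀} w₀∈W
      (λ {x} x∈W x≉w₀ → τ∉W {x} x∈W x≉w₀ ∘ resp W {reflect w₀ x} {act (τ w₀) x} (reflect≈τ w₀ x))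
      w w∈W w≉w₀ (λ {i} {j} → w-injective {i} {j})
      (λ x x∉W → c₀ ⟨$⟩ (x , x∉W))
      (λ {x} {y} x∉W y∉W x≈y → Func.cong c₀ {x , x∉W} {y , y∉W} x≈y)
      λ h h-cong h-extends →
        symmetry h (λ {x} {y} → h-cong {x} {y}) (decidable-stable em λ distinguishing →
          ¬extension (colouring h (λ {x} {y} → h-cong {x} {y}) , h-extends , distinguishing))
    where
    colouring : ∀ h → (∀ {x y} → x ≈ y → h x ≡ h y) → Coloring
    colouring h h-cong = record { to = h ; cong = λ {x} {y} → h-cong {x} {y} }

    symmetry : ∀ h (h-cong : ∀ {x y} → x ≈ y → h x ≡ h y) →
      ∃[ γ ] ¬ IsIdentity γ × Preserves γ (colouring h (λ {x} {y} → h-cong {x} {y})) →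
      Symmetry S¹-abelianGroup _≟_ h
    symmetry h h-cong (σ t , σt≢1 , preserves) = translation t (σ-nonidentity {t} σt≢1) preserves
    symmetry h h-cong (τ a , _ , preserves) =
      mirror-symmetry S¹-abelianGroup _≟_ (λ {x} {y} → h-cong {x} {y}) a λ x →
      ≡.trans (h-cong {reflect a x} {act (τ a) x} (reflect≈τ a x)) (preserves x)
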